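{- Let $\Sigma=\{a\}$ be a one-letter alphabet. The axioms of synchronous Kleene algebra are incomplete with respect to the synchronous language semantics: there exist $e,f\in\mathcal{T}_{\mathsf{SKA}}$ (synchronous regular terms over $\Sigma$) such that $[\![e]\!]_{\mathsf{SKA}}=[\![f]\!]_{\mathsf{SKA}}$ but $e\not\equiv_{\mathsf{SKA}} f$.
   Context: Let $\Sigma$ be a finite alphabet and let $\mathcal{P}_n(\Sigma)$ be the set of non-empty subsets of $\Sigma$. Terms. The semilattice terms $\mathcal{T}_{\mathsf{SL}}$ are given by $e,f ::= a\in\Sigma \mid e\times f$. The synchronous regular terms $\mathcal{T}_{\mathsf{SKA}}$ are given by $e,f ::= 0\mid 1\mid a\in\mathcal{T}_{\mathsf{SL}}\mid e+f\mid e\cdot f\mid e\times f\mid e^*$ (so $\mathcal{T}_{\mathsf{SL}}\subseteq\mathcal{T}_{\mathsf{SKA}}$, and the $\times$ of two semilattice terms is the same term whether formed in $\mathcal{T}_{\mathsf{SL}}$ or in $\mathcal{T}_{\mathsf{SKA}}$). Provable equivalence. $\equiv_{\mathsf{SKA}}$ is the smallest congruence $\equiv$ on $\mathcal{T}_{\mathsf{SKA}}$ (with respect to $+,\cdot,\times,{}^*$) satisfying the following for all $e,f,g\in\mathcal{T}_{\mathsf{SKA}}$ and all $\alpha,\beta\in\mathcal{T}_{\mathsf{SL}}$, where $e\leq f$ abbreviates $e+f\equiv f$: - $e+(f+g)\equiv(e+f)+g$, $e+f\equiv f+e$, $e+0\equiv e$, $e+e\equiv e$; - $e\cdot 1\equiv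 e\equiv 1\cdot e$, $e\cdot 0\equiv 0\equiv 0\cdot e$, $e\cdot(f\cdot g)\equiv(e\cdot f)\cdot g$, $(e+f)\cdot g\equiv e\cdot g+f\cdot g$, $e\cdot(f+g)\equiv e\cdot f+e\cdot g$; - $e^*\equiv 1+e\cdot e^*\equiv 1+e^*\cdot e$; - (least fixpoint axioms) $e+f\cdot g\leq g$ implies $f^*\cdot e\leq g$; and $e+f\cdot g\leq f$ implies $e\cdot g^*\leq f$; - $e\times(f+g)\equiv e\times f+e\times g$, $e\times(f\times g)\equiv(e\times f)\times g$, $e\times f\equiv f\times e$, $e\times 0\equiv 0$, $e\times 1\equiv e$; - $\alpha\times\alpha\equiv\alpha$, and $(\alpha\cdot e)\times(\beta\cdot f)\equiv(\alpha\times\beta)\cdot(e\times f)$. Semantics. Synchronous strings are words over the alphabet $\mathcal{P}_n(\Sigma)$; synchronous languages are sets of synchronous strings, with the usual union, concatenation and Kleene star. The synchronous product of strings is defined by $u\times\varepsilon=u=\varepsilon\times u$ and $(x u)\times(y v)=(x\cup y)(u\times v)$ for $x,y\in\mathcal{P}_n(\Sigma)$, and of languages by $K\times L=\{u\times v: u\in K,v\in L\}$. Define $[\![-]\!]_{\mathsf{SL}}:\mathcal{T}_{\mathsf{SL}}\to\mathcal{P}_n(\Sigma)$ by $[\![a]\!]_{\mathsf{SL}}=\{a\}$ for $a\in\Sigma$ and $[\![e\times f]\!]_{\mathsf{SL}}=[\![e]\!]_{\mathsf{SL}}\cup[\![f]\!]_{\mathsf{SL}}$. The map $[\![-]\!]_{\mathsf{SKA}}$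 from $\mathcal{T}_{\mathsf{SKA}}$ to synchronous languages is given by $[\![0]\!]=\emptyset$, $[\![1]\!]=\{\varepsilon\}$, $[\![a]\!]=\{[\![a]\!]_{\mathsf{SL}}\}$ (a single one-letter word) for $a\in\mathcal{T}_{\mathsf{SL}}$, $[\![e+f]\!]=[\![e]\!]\cup[\![f]\!]$, $[\![e\cdot f]\!]=[\![e]\!]\cdot[\![f]\!]$, $[\![e\times f]\!]=[\![e]\!]\times[\![f]\!]$, $[\![e^*]\!]=[\![e]\!]^*$. -}

module Defs where

open import Data.Fin.Base using (Fin)
open import Data.Fin.Subset as Subset using (Subset; Nonempty; ⁅_⁆)
open import Data.Fin.Subset.Properties using (x∈⁅x⁆; x∈p∪q⁺)
import Data.Irrelevant as Irrelevant
open import Data.List.Base using (List; []; _∷_; [_]; _++_; concat)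
open import Data.List.Relation.Unary.All using (All)
open import Data.Nat.Base using (ℕ)
open import Data.Product.Base using (∃; ∃₂; _×_; _,_; map₂)
open import Data.Refinement.Base using (Refinement-syntax; _,_; value; proof)
open import Data.Sum.Base using (inj₁)
open import Level using (0ℓ)
open import Relation.Binary.PropositionalEquality using (_≡_; refl)
open import Relation.Unary using (Pred; _∈_; _∪_; ∅; ｛_｝; _≐_)

-- The alphabet with n letters is Fin n throughout.

private
  variable
    n : ℕ

infixl 8 _⊗_
infixl 7 _·_
infixl 6 _+_
infix  9 _*

data SLTerm (n : ℕ) : Set where
  letter : Fin n → SLTerm n
  _⊗_    : SLTerm n → SLTerm n → SLTerm n

-- There is a single constructor _⊗_, so the product of two semilattice terms
-- is the same term whether it is formed before or after the inclusion ⌜_⌝.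
data Term (n : ℕ) : Set where
  𝟘 𝟙         : Term n
  letter      : Fin n → Term n
  _+_ _·_ _⊗_ : Term n → Term n → Term n
  _*          : Term n → Term n

⌜_⌝ : SLTerm n → Term n
⌜ letter a ⌝ = letter a
⌜ α ⊗ β    ⌝ = ⌜ α ⌝ ⊗ ⌜ β ⌝

infix 4 _≡SKA_ _≤SKA_

data _≡SKA_ {n : ℕ} : Term n → Term n → Set

_≤SKA_ : Term n → Term n → Set
e ≤SKA f = e + f ≡SKA f

data _≡SKA_ {n} where
  ≡-refl  : ∀ {e} → e ≡SKA e
  ≡-sym   : ∀ {e f} → e ≡SKA f → f ≡SKA e
  ≡-trans : ∀ {e f g} → e ≡SKA f → f ≡SKA g → e ≡SKA g

  +-cong : ∀ {e e′ f f′} → e ≡SKA e′ → f ≡SKA f′ → e + f ≡SKA e′ + f′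
  ·-cong : ∀ {e e′ f f′} → e ≡SKA e′ → f ≡SKA f′ → e · f ≡SKA e′ · f′
  ⊗-cong : ∀ {e e′ f f′} → e ≡SKA e′ → f ≡SKA f′ → e ⊗ f ≡SKA e′ ⊗ f′
  *-cong : ∀ {e e′} → e ≡SKA e′ → e * ≡SKA e′ *

  +-assoc     : ∀ e f g → e + (f + g) ≡SKA (e + f) + g
  +-comm      : ∀ e f → e + f ≡SKA f + e
  +-identityʳ : ∀ e → e + 𝟘 ≡SKA e
  +-idem      : ∀ e → e + e ≡SKA e

  ·-identityʳ : ∀ e → e · 𝟙 ≡SKA e
  ·-identityˡ : ∀ e → 𝟙 · e ≡SKA e
  ·-zeroʳ     : ∀ e → e · 𝟘 ≡SKA 𝟘
  ·-zeroˡ     : ∀ e → 𝟘 · e ≡SKA 𝟘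
  ·-assoc     : ∀ e f g → e · (f · g) ≡SKA (e · f) · g
  ·-distribʳ  : ∀ e f g → (e + f) · g ≡SKA e · g + f · g
  ·-distribˡ  : ∀ e f g → e · (f + g) ≡SKA e · f + e · g

  *-unfoldʳ : ∀ e → e * ≡SKA 𝟙 + e · e *
  *-unfoldˡ : ∀ e → e * ≡SKA 𝟙 + e * · e
  *-leastˡ  : ∀ e f g → e + f · g ≤SKA g → f * · e ≤SKA g
  *-leastʳ  : ∀ e f g → e + f · g ≤SKA f → e · g * ≤SKA f

  ⊗-distribˡ  : ∀ e f g → e ⊗ (f + g) ≡SKA e ⊗ f + e ⊗ g
  ⊗-assoc     : ∀ e f g → e ⊗ (f ⊗ g) ≡SKA (e ⊗ f) ⊗ g
  ⊗-comm      : ∀ e f → e ⊗ f ≡SKA f ⊗ e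
  ⊗-zeroʳ     : ∀ e → e ⊗ 𝟘 ≡SKA 𝟘
  ⊗-identityʳ : ∀ e → e ⊗ 𝟙 ≡SKA e

  ⊗-idem : ∀ α → ⌜ α ⌝ ⊗ ⌜ α ⌝ ≡SKA ⌜ α ⌝
  ⊗-sync : ∀ α β e f →
           (⌜ α ⌝ · e) ⊗ (⌜ β ⌝ · f) ≡SKA (⌜ α ⌝ ⊗ ⌜ β ⌝) · (e ⊗ f)

-- Non-emptiness is an irrelevant component, so propositional equality of
-- elements of 𝒫ₙ is equality of the underlying subsets.
𝒫ₙ : ℕ → Set
𝒫ₙ n = [ p ∈ Subset n ∣ Nonempty p ]

infixr 6 _∪ₙ_

_∪ₙ_ : 𝒫ₙ n → 𝒫ₙ n → 𝒫ₙ n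
x ∪ₙ y = value x Subset.∪ value y
       , Irrelevant.map (map₂ (λ i∈x → x∈p∪q⁺ (inj₁ i∈x))) (proof x)

SyncString : ℕ → Set
SyncString n = List (𝒫ₙ n)

SyncLanguage : ℕ → Set₁
SyncLanguage n = Pred (SyncString n) 0ℓ

infixl 8 _×ₛ_ _×ₗ_
infixl 7 _·ₗ_
infix  9 _*ₗ

_×ₛ_ : SyncString n → SyncString n → SyncString n
[]      ×ₛ v       = v
(x ∷ u) ×ₛ []      = x ∷ u
(x ∷ u) ×ₛ (y ∷ v) = (x ∪ₙ y) ∷ (u ×ₛ v)

_×ₗ_ : SyncLanguage n → SyncLanguage n → SyncLanguage n
(K ×ₗ L) w = ∃₂ λ u v → u ∈ K × v ∈ L × w ≡ u ×ₛ v

_·ₗ_ : SyncLanguage n → SyncLanguage n → SyncLanguage n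
(K ·ₗ L) w = ∃₂ λ u v → u ∈ K × v ∈ L × w ≡ u ++ v

_*ₗ : SyncLanguage n → SyncLanguage n
(L *ₗ) w = ∃ λ us → All L us × w ≡ concat us

⟦_⟧SL : SLTerm n → 𝒫ₙ n
⟦ letter a ⟧SL = ⁅ a ⁆ , Irrelevant.[ a , x∈⁅x⁆ a ]
⟦ α ⊗ β    ⟧SL = ⟦ α ⟧SL ∪ₙ ⟦ β ⟧SL

⟦_⟧SKA : Term n → SyncLanguage n
⟦ 𝟘        ⟧SKA = ∅
⟦ 𝟙        ⟧SKA = ｛ [] ｝
⟦ letter a ⟧SKA = ｛ [ ⟦ letter a ⟧SL ] ｝
⟦ e + f    ⟧SKA = ⟦ e ⟧SKA ∪ ⟦ f ⟧SKA
⟦ e · f    ⟧SKA = ⟦ e ⟧SKA ·ₗ ⟦ f ⟧SKA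
⟦ e ⊗ f    ⟧SKA = ⟦ e ⟧SKA ×ₗ ⟦ f ⟧SKA
⟦ e *      ⟧SKA = ⟦ e ⟧SKA *ₗ

-- The clause ⟦ α ⟧ = { ⟦ α ⟧SL } for arbitrary semilattice terms α is not a
-- defining equation above: the clauses for letters and _⊗_ already force it.
⟦⌜_⌝⟧SKA : (α : SLTerm n) → ⟦ ⌜ α ⌝ ⟧SKA ≐ ｛ [ ⟦ α ⟧SL ] ｝
⟦⌜ letter a ⌝⟧SKA = (λ w∈ → w∈) , (λ w∈ → w∈)
⟦⌜ α ⊗ β ⌝⟧SKA with ⟦⌜ α ⌝⟧SKA | ⟦⌜ β ⌝⟧SKA
... | α⊆ , ⊆α | β⊆ , ⊆β = to , from
  where
  to : ∀ {w} → w ∈ ⟦ ⌜ α ⊗ β ⌝ ⟧SKA → [ ⟦ α ⊗ β ⟧SL ] ≡ w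
  to (u , v , u∈ , v∈ , refl) with refl ← α⊆ u∈ | refl ← β⊆ v∈ = refl

  from : ∀ {w} → [ ⟦ α ⊗ β ⟧SL ] ≡ w → w ∈ ⟦ ⌜ α ⊗ β ⌝ ⟧SKA
  from refl = _ , _ , ⊆α refl , ⊆β refl , refl

{-# OPTIONS --safe #-}

-- The terms a* × a* and a* both denote all synchronous strings. They are
-- separated by recording only the maximal length of a language, refined by a
-- value † above ω: the synchronous product of two unbounded languages is sent
-- to †. No axiom forces ω ⊠ ω ≡ ω, because idempotence of × is only required
-- on semilattice terms, which have length 1, and the only law governing * is
-- its least-fixpoint property with respect to concatenation.
module Submission where

open import Defs
open import Data.Bool.Base using (true; false)
open import Data.Empty using (⊥-elim; ⊥-elim-irr)
open import Data.Fin.Base using (zero)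
open import Data.Fin.Subset.Properties using (∉⊥)
open import Data.Irrelevant using ([_])
open import Data.List.Base using ([]; _∷_)
open import Data.List.Relation.Unary.All using ([]; _∷_)
open import Data.Nat.Base as ℕ using (ℕ; zero; suc)
import Data.Nat.Properties as ℕ
open import Data.Product using (_×_; ∃₂; _,_; proj₂)
open import Data.Refinement.Base using (_,_)
open import Data.Vec.Base using ([]; _∷_)
open import Function.Base using (case_of_)
open import Relation.Binary.PropositionalEquality
open import Relation.Nullary using (¬_)
open import Relation.Unary using (_≐_; _∈_)

-- The algebra of maximal lengths.

data Length : Set where
  ∅   : Length
  len : ℕ → Length
  ω   : Length
  †   : Length

infixl 8 _⊠_
infixl 7 _∙_
infixl 6 _⊔_
infix  9 _⋆
infix  4 _≤_

-- Maximum in the chain `∅` < `len 0` < `len 1` < ... < `ω` < `†`. The empty language lies below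
-- `len 0`, since zero and unit must stay distinct.
_⊔_ : Length → Length → Length
∅     ⊔ y     = y
len m ⊔ ∅     = len m
len m ⊔ len n = len (m ℕ.⊔ n)
len m ⊔ ω     = ω
len m ⊔ †     = †
ω     ⊔ ∅     = ω
ω     ⊔ len n = ω
ω     ⊔ ω     = ω
ω     ⊔ †     = †
†     ⊔ y     = †

-- Addition of lengths, with `ω` and `†` absorbing finite values, and `∅` annihilating even `†`.
_∙_ : Length → Length → Length
∅     ∙ y     = ∅
len m ∙ ∅     = ∅
len m ∙ len n = len (m ℕ.+ n)
len m ∙ ω     = ω
len m ∙ †     = †
ω     ∙ ∅     = ∅
ω     ∙ len n = ω
ω     ∙ ω     = ω
ω     ∙ †     = †
†     ∙ ∅     = ∅
†     ∙ len n = †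
†     ∙ ω     = †
†     ∙ †     = †

-- Away from `∅`, which annihilates, this is the maximum with a single exception: `ω ⊠ ω` is `†`
-- instead of `ω`.
_⊠_ : Length → Length → Length
∅     ⊠ y     = ∅
len m ⊠ ∅     = ∅
len m ⊠ len n = len (m ℕ.⊔ n)
len m ⊠ ω     = ω
len m ⊠ †     = †
ω     ⊠ ∅     = ∅
ω     ⊠ len n = ω
ω     ⊠ ω     = †
ω     ⊠ †     = †
†     ⊠ ∅     = ∅
†     ⊠ len n = †
†     ⊠ ω     = †
†     ⊠ †     = †

-- The value at `x` is the least `y` with `len 0 ⊔ x ∙ y ≤ y`. In particular star alone never
-- produces `†` from a smaller value.
_⋆ : Length → Length
∅           ⋆ = len 0
len zero    ⋆ = len 0
len (suc n) ⋆ = ω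
ω           ⋆ = ω
†           ⋆ = †

_≤_ : Length → Length → Set
x ≤ y = x ⊔ y ≡ y

-- Laws of join, concatenation and synchronous product.

⊔-comm : ∀ x y → x ⊔ y ≡ y ⊔ x
⊔-comm ∅       ∅       = refl
⊔-comm ∅       (len n) = refl
⊔-comm ∅       ω       = refl
⊔-comm ∅       †       = refl
⊔-comm (len m) ∅       = refl
⊔-comm (len m) (len n) = cong len (ℕ.⊔-comm m n)
⊔-comm (len m) ω       = refl
⊔-comm (len m) †       = refl
⊔-comm ω       ∅       = refl
⊔-comm ω       (len n) = refl
⊔-comm ω       ω       = refl
⊔-comm ω       †       = refl
⊔-comm †       ∅       = refl
⊔-comm †       (len n) = refl
⊔-comm †       ω       = refl
⊔-comm †       †       = refl

⊔-assoc : ∀ x y z → x ⊔ (y ⊔ z) ≡ (x ⊔ y) ⊔ z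
⊔-assoc ∅       y       z       = refl
⊔-assoc (len k) ∅       z       = refl
⊔-assoc (len k) (len m) ∅       = refl
⊔-assoc (len k) (len m) (len n) = cong len (sym (ℕ.⊔-assoc k m n))
⊔-assoc (len k) (len m) ω       = refl
⊔-assoc (len k) (len m) †       = refl
⊔-assoc (len k) ω       ∅       = refl
⊔-assoc (len k) ω       (len n) = refl
⊔-assoc (len k) ω       ω       = refl
⊔-assoc (len k) ω       †       = refl
⊔-assoc (len k) †       z       = refl
⊔-assoc ω       ∅       z       = refl
⊔-assoc ω       (len m) ∅       = refl
⊔-assoc ω       (len m) (len n) = refl
⊔-assoc ω       (len m) ω       = refl
⊔-assoc ω       (len m) †       = refl
⊔-assoc ω       ω       ∅       = refl
⊔-assoc ω       ω       (len n) = refl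
⊔-assoc ω       ω       ω       = refl
⊔-assoc ω       ω       †       = refl
⊔-assoc ω       †       z       = refl
⊔-assoc †       y       z       = refl

⊔-idem : ∀ x → x ⊔ x ≡ x
⊔-idem ∅       = refl
⊔-idem (len n) = cong len (ℕ.⊔-idem n)
⊔-idem ω       = refl
⊔-idem †       = refl

-- Lengths forget the order of concatenation. This lets every right-handed axiom be derived from its
-- left-handed counterpart.
∙-comm : ∀ x y → x ∙ y ≡ y ∙ x
∙-comm ∅       ∅       = refl
∙-comm ∅       (len n) = refl
∙-comm ∅       ω       = refl
∙-comm ∅       †       = refl
∙-comm (len m) ∅       = refl
∙-comm (len m) (len n) = cong len (ℕ.+-comm m n)
∙-comm (len m) ω       = refl
∙-comm (len m) †       = refl
∙-comm ω       ∅       = refl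
∙-comm ω       (len n) = refl
∙-comm ω       ω       = refl
∙-comm ω       †       = refl
∙-comm †       ∅       = refl
∙-comm †       (len n) = refl
∙-comm †       ω       = refl
∙-comm †       †       = refl

∙-assoc : ∀ x y z → x ∙ (y ∙ z) ≡ (x ∙ y) ∙ z
∙-assoc ∅       y       z       = refl
∙-assoc (len k) ∅       z       = refl
∙-assoc (len k) (len m) ∅       = refl
∙-assoc (len k) (len m) (len n) = cong len (sym (ℕ.+-assoc k m n))
∙-assoc (len k) (len m) ω       = refl
∙-assoc (len k) (len m) †       = refl
∙-assoc (len k) ω       ∅       = refl
∙-assoc (len k) ω       (len n) = refl
∙-assoc (len k) ω       ω       = refl
∙-assoc (len k) ω       †       = refl
∙-assoc (len k) †       ∅       = refl
∙-assoc (len k) †       (len n) = refl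
∙-assoc (len k) †       ω       = refl
∙-assoc (len k) †       †       = refl
∙-assoc ω       ∅       z       = refl
∙-assoc ω       (len m) ∅       = refl
∙-assoc ω       (len m) (len n) = refl
∙-assoc ω       (len m) ω       = refl
∙-assoc ω       (len m) †       = refl
∙-assoc ω       ω       ∅       = refl
∙-assoc ω       ω       (len n) = refl
∙-assoc ω       ω       ω       = refl
∙-assoc ω       ω       †       = refl
∙-assoc ω       †       ∅       = refl
∙-assoc ω       †       (len n) = refl
∙-assoc ω       †       ω       = refl
∙-assoc ω       †       †       = refl
∙-assoc †       ∅       z       = refl
∙-assoc †       (len m) ∅       = refl
∙-assoc †       (len m) (len n) = refl
∙-assoc †       (len m) ω       = refl
∙-assoc †       (len m) †       = refl
∙-assoc †       ω       ∅       = refl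
∙-assoc †       ω       (len n) = refl
∙-assoc †       ω       ω       = refl
∙-assoc †       ω       †       = refl
∙-assoc †       †       ∅       = refl
∙-assoc †       †       (len n) = refl
∙-assoc †       †       ω       = refl
∙-assoc †       †       †       = refl

∙-distribˡ : ∀ x y z → x ∙ (y ⊔ z) ≡ x ∙ y ⊔ x ∙ z
∙-distribˡ ∅       y       z       = refl
∙-distribˡ (len k) ∅       z       = refl
∙-distribˡ (len k) (len m) ∅       = refl
∙-distribˡ (len k) (len m) (len n) = cong len (ℕ.+-distribˡ-⊔ k m n)
∙-distribˡ (len k) (len m) ω       = refl
∙-distribˡ (len k) (len m) †       = refl
∙-distribˡ (len k) ω       ∅       = refl
∙-distribˡ (len k) ω       (len n) = refl
∙-distribˡ (len k) ω       ω       = refl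
∙-distribˡ (len k) ω       †       = refl
∙-distribˡ (len k) †       ∅       = refl
∙-distribˡ (len k) †       (len n) = refl
∙-distribˡ (len k) †       ω       = refl
∙-distribˡ (len k) †       †       = refl
∙-distribˡ ω       ∅       z       = refl
∙-distribˡ ω       (len m) ∅       = refl
∙-distribˡ ω       (len m) (len n) = refl
∙-distribˡ ω       (len m) ω       = refl
∙-distribˡ ω       (len m) †       = refl
∙-distribˡ ω       ω       ∅       = refl
∙-distribˡ ω       ω       (len n) = refl
∙-distribˡ ω       ω       ω       = refl
∙-distribˡ ω       ω       †       = refl
∙-distribˡ ω       †       ∅       = refl
∙-distribˡ ω       †       (len n) = refl
∙-distribˡ ω       †       ω       = refl
∙-distribˡ ω       †       †       = refl
∙-distribˡ †       ∅       z       = refl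
∙-distribˡ †       (len m) ∅       = refl
∙-distribˡ †       (len m) (len n) = refl
∙-distribˡ †       (len m) ω       = refl
∙-distribˡ †       (len m) †       = refl
∙-distribˡ †       ω       ∅       = refl
∙-distribˡ †       ω       (len n) = refl
∙-distribˡ †       ω       ω       = refl
∙-distribˡ †       ω       †       = refl
∙-distribˡ †       †       ∅       = refl
∙-distribˡ †       †       (len n) = refl
∙-distribˡ †       †       ω       = refl
∙-distribˡ †       †       †       = refl

⊠-comm : ∀ x y → x ⊠ y ≡ y ⊠ x
⊠-comm ∅       ∅       = refl
⊠-comm ∅       (len n) = refl
⊠-comm ∅       ω       = refl
⊠-comm ∅       †       = refl
⊠-comm (len m) ∅       = refl
⊠-comm (len m) (len n) = cong len (ℕ.⊔-comm m n)
⊠-comm (len m) ω       = refl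
⊠-comm (len m) †       = refl
⊠-comm ω       ∅       = refl
⊠-comm ω       (len n) = refl
⊠-comm ω       ω       = refl
⊠-comm ω       †       = refl
⊠-comm †       ∅       = refl
⊠-comm †       (len n) = refl
⊠-comm †       ω       = refl
⊠-comm †       †       = refl

-- The exception `ω ⊠ ω ≡ †` is harmless: without `∅` among the factors, either bracketing gives `†`
-- exactly when some factor is `†` or at least two are `ω`.
⊠-assoc : ∀ x y z → x ⊠ (y ⊠ z) ≡ (x ⊠ y) ⊠ z
⊠-assoc ∅       y       z       = refl
⊠-assoc (len k) ∅       z       = refl
⊠-assoc (len k) (len m) ∅       = refl
⊠-assoc (len k) (len m) (len n) = cong len (sym (ℕ.⊔-assoc k m n))
⊠-assoc (len k) (len m) ω       = refl
⊠-assoc (len k) (len m) †       = refl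
⊠-assoc (len k) ω       ∅       = refl
⊠-assoc (len k) ω       (len n) = refl
⊠-assoc (len k) ω       ω       = refl
⊠-assoc (len k) ω       †       = refl
⊠-assoc (len k) †       ∅       = refl
⊠-assoc (len k) †       (len n) = refl
⊠-assoc (len k) †       ω       = refl
⊠-assoc (len k) †       †       = refl
⊠-assoc ω       ∅       z       = refl
⊠-assoc ω       (len m) ∅       = refl
⊠-assoc ω       (len m) (len n) = refl
⊠-assoc ω       (len m) ω       = refl
⊠-assoc ω       (len m) †       = refl
⊠-assoc ω       ω       ∅       = refl
⊠-assoc ω       ω       (len n) = refl
⊠-assoc ω       ω       ω       = refl
⊠-assoc ω       ω       †       = refl
⊠-assoc ω       †       ∅       = refl
⊠-assoc ω       †       (len n) = refl
⊠-assoc ω       †       ω       = refl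
⊠-assoc ω       †       †       = refl
⊠-assoc †       ∅       z       = refl
⊠-assoc †       (len m) ∅       = refl
⊠-assoc †       (len m) (len n) = refl
⊠-assoc †       (len m) ω       = refl
⊠-assoc †       (len m) †       = refl
⊠-assoc †       ω       ∅       = refl
⊠-assoc †       ω       (len n) = refl
⊠-assoc †       ω       ω       = refl
⊠-assoc †       ω       †       = refl
⊠-assoc †       †       ∅       = refl
⊠-assoc †       †       (len n) = refl
⊠-assoc †       †       ω       = refl
⊠-assoc †       †       †       = refl

-- Each map `x ⊠_` is monotone, also for `x = ω`, where it jumps from `ω` to `†`; a monotone map on
-- a chain preserves binary maxima.
⊠-distribˡ : ∀ x y z → x ⊠ (y ⊔ z) ≡ x ⊠ y ⊔ x ⊠ z
⊠-distribˡ ∅       y       z       = refl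
⊠-distribˡ (len k) ∅       z       = refl
⊠-distribˡ (len k) (len m) ∅       = refl
⊠-distribˡ (len k) (len m) (len n) = cong len (ℕ.mono-≤-distrib-⊔ (ℕ.⊔-monoʳ-≤ k) m n)
⊠-distribˡ (len k) (len m) ω       = refl
⊠-distribˡ (len k) (len m) †       = refl
⊠-distribˡ (len k) ω       ∅       = refl
⊠-distribˡ (len k) ω       (len n) = refl
⊠-distribˡ (len k) ω       ω       = refl
⊠-distribˡ (len k) ω       †       = refl
⊠-distribˡ (len k) †       ∅       = refl
⊠-distribˡ (len k) †       (len n) = refl
⊠-distribˡ (len k) †       ω       = refl
⊠-distribˡ (len k) †       †       = refl
⊠-distribˡ ω       ∅       z       = refl
⊠-distribˡ ω       (len m) ∅       = refl
⊠-distribˡ ω       (len m) (len n) = refl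
⊠-distribˡ ω       (len m) ω       = refl
⊠-distribˡ ω       (len m) †       = refl
⊠-distribˡ ω       ω       ∅       = refl
⊠-distribˡ ω       ω       (len n) = refl
⊠-distribˡ ω       ω       ω       = refl
⊠-distribˡ ω       ω       †       = refl
⊠-distribˡ ω       †       ∅       = refl
⊠-distribˡ ω       †       (len n) = refl
⊠-distribˡ ω       †       ω       = refl
⊠-distribˡ ω       †       †       = refl
⊠-distribˡ †       ∅       z       = refl
⊠-distribˡ †       (len m) ∅       = refl
⊠-distribˡ †       (len m) (len n) = refl
⊠-distribˡ †       (len m) ω       = refl
⊠-distribˡ †       (len m) †       = refl
⊠-distribˡ †       ω       ∅       = refl
⊠-distribˡ †       ω       (len n) = refl
⊠-distribˡ †       ω       ω       = refl
⊠-distribˡ †       ω       †       = refl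
⊠-distribˡ †       †       ∅       = refl
⊠-distribˡ †       †       (len n) = refl
⊠-distribˡ †       †       ω       = refl
⊠-distribˡ †       †       †       = refl

-- `len 1 ∙_` is the successor on finite lengths, which commutes with the maximum, and it fixes `∅`,
-- `ω` and `†`.
∙-⊠-interchange : ∀ x y → (len 1 ∙ x) ⊠ (len 1 ∙ y) ≡ len 1 ∙ (x ⊠ y)
∙-⊠-interchange ∅       y       = refl
∙-⊠-interchange (len m) ∅       = refl
∙-⊠-interchange (len m) (len n) = refl
∙-⊠-interchange (len m) ω       = refl
∙-⊠-interchange (len m) †       = refl
∙-⊠-interchange ω       ∅       = refl
∙-⊠-interchange ω       (len n) = refl
∙-⊠-interchange ω       ω       = refl
∙-⊠-interchange ω       †       = refl
∙-⊠-interchange †       ∅       = refl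
∙-⊠-interchange †       (len n) = refl
∙-⊠-interchange †       ω       = refl
∙-⊠-interchange †       †       = refl

∙-identityˡ : ∀ x → len 0 ∙ x ≡ x
∙-identityˡ ∅       = refl
∙-identityˡ (len n) = refl
∙-identityˡ ω       = refl
∙-identityˡ †       = refl

⊠-identityˡ : ∀ x → len 0 ⊠ x ≡ x
⊠-identityˡ ∅       = refl
⊠-identityˡ (len n) = refl
⊠-identityˡ ω       = refl
⊠-identityˡ †       = refl

∙-distribʳ : ∀ x y z → (x ⊔ y) ∙ z ≡ x ∙ z ⊔ y ∙ z
∙-distribʳ x y z = begin
  (x ⊔ y) ∙ z    ≡⟨ ∙-comm (x ⊔ y) z ⟩
  z ∙ (x ⊔ y)    ≡⟨ ∙-distribˡ z x y ⟩
  z ∙ x ⊔ z ∙ y  ≡⟨ cong₂ _⊔_ (∙-comm z x) (∙-comm z y) ⟩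
  x ∙ z ⊔ y ∙ z  ∎
  where open ≡-Reasoning

-- Star and its least-fixpoint property.

⋆-unfold : ∀ x → x ⋆ ≡ len 0 ⊔ x ∙ x ⋆
⋆-unfold ∅             = refl
⋆-unfold (len zero)    = refl
⋆-unfold (len (suc n)) = refl
⋆-unfold ω             = refl
⋆-unfold †             = refl

≤-trans : ∀ {x y z} → x ≤ y → y ≤ z → x ≤ z
≤-trans {x} {y} {z} x≤y y≤z = begin
  x ⊔ z        ≡⟨ cong (x ⊔_) y≤z ⟨
  x ⊔ (y ⊔ z)  ≡⟨ ⊔-assoc x y z ⟩
  (x ⊔ y) ⊔ z  ≡⟨ cong (_⊔ z) x≤y ⟩
  y ⊔ z        ≡⟨ y≤z ⟩
  z            ∎
  where open ≡-Reasoning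

x≤x⊔y : ∀ x y → x ≤ x ⊔ y
x≤x⊔y x y = trans (⊔-assoc x x y) (cong (_⊔ y) (⊔-idem x))

y≤x⊔y : ∀ x y → y ≤ x ⊔ y
y≤x⊔y x y = subst (y ≤_) (⊔-comm y x) (x≤x⊔y y x)

∙-monoʳ-≤ : ∀ x {y z} → y ≤ z → x ∙ y ≤ x ∙ z
∙-monoʳ-≤ x {y} {z} y≤z = trans (sym (∙-distribˡ x y z)) (cong (x ∙_) y≤z)

len-injective : ∀ {m n} → len m ≡ len n → m ≡ n
len-injective refl = refl

-- If `x` is `∅` or `len 0`, its star is the unit. If `x` is a positive length, `y` cannot be
-- finite, and `ω ∙ y` equals `y` for the remaining values. On `ω` and `†` star is the identity.
⋆-closed : ∀ x y → x ∙ y ≤ y → x ⋆ ∙ y ≤ y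
⋆-closed ∅             y       _    = trans (cong (_⊔ y) (∙-identityˡ y)) (⊔-idem y)
⋆-closed (len zero)    y       xy≤y = xy≤y
⋆-closed (len (suc m)) ∅       _    = refl
⋆-closed (len (suc m)) (len n) xy≤y =
  -- The hypothesis would give `suc m + n ≤ n`.
  ⊥-elim (ℕ.m+1+n≰m n (subst (ℕ._≤ n) (ℕ.+-comm (suc m) n) (ℕ.m⊔n≡n⇒m≤n (len-injective xy≤y))))
⋆-closed (len (suc m)) ω       _    = refl
⋆-closed (len (suc m)) †       _    = refl
⋆-closed ω             y       xy≤y = xy≤y
⋆-closed †             y       xy≤y = xy≤y

-- The hypothesis splits into `x ≤ z` and `y ∙ z ≤ z`, whence `y ⋆ ∙ x ≤ y ⋆ ∙ z ≤ z`.
⋆-least : ∀ x y z → x ⊔ y ∙ z ≤ z → y ⋆ ∙ x ≤ z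
⋆-least x y z h = ≤-trans {y = y ⋆ ∙ z}
  (∙-monoʳ-≤ (y ⋆) (≤-trans {y = x ⊔ y ∙ z} (x≤x⊔y x (y ∙ z)) h))
  (⋆-closed y z (≤-trans {y = x ⊔ y ∙ z} (y≤x⊔y x (y ∙ z)) h))

-- Interpretation of terms and soundness of the axioms.

module _ {n : ℕ} where

  ⟦_⟧ : Term n → Length
  ⟦ 𝟘        ⟧ = ∅
  ⟦ 𝟙        ⟧ = len 0
  ⟦ letter a ⟧ = len 1
  ⟦ e + f    ⟧ = ⟦ e ⟧ ⊔ ⟦ f ⟧
  ⟦ e · f    ⟧ = ⟦ e ⟧ ∙ ⟦ f ⟧
  ⟦ e ⊗ f    ⟧ = ⟦ e ⟧ ⊠ ⟦ f ⟧
  ⟦ e *      ⟧ = ⟦ e ⟧ ⋆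

  -- Synchronous product takes the maximum of finite lengths, so it never leaves length 1. The
  -- axioms restricted to semilattice terms thus concern `len 1` only.
  ⟦⌜⌝⟧≡len1 : ∀ α → ⟦ ⌜ α ⌝ ⟧ ≡ len 1
  ⟦⌜⌝⟧≡len1 (letter a) = refl
  ⟦⌜⌝⟧≡len1 (α ⊗ β) rewrite ⟦⌜⌝⟧≡len1 α | ⟦⌜⌝⟧≡len1 β = refl

  sound : ∀ {e f} → e ≡SKA f → ⟦ e ⟧ ≡ ⟦ f ⟧
  sound ≡-refl              = refl
  sound (≡-sym p)           = sym (sound p)
  sound (≡-trans p q)       = trans (sound p) (sound q)
  sound (+-cong p q)        = cong₂ _⊔_ (sound p) (sound q)
  sound (·-cong p q)        = cong₂ _∙_ (sound p) (sound q)
  sound (⊗-cong p q)        = cong₂ _⊠_ (sound p) (sound q)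
  sound (*-cong p)          = cong _⋆ (sound p)
  sound (+-assoc e f g)     = ⊔-assoc ⟦ e ⟧ ⟦ f ⟧ ⟦ g ⟧
  sound (+-comm e f)        = ⊔-comm ⟦ e ⟧ ⟦ f ⟧
  sound (+-identityʳ e)     = ⊔-comm ⟦ e ⟧ ∅
  sound (+-idem e)          = ⊔-idem ⟦ e ⟧
  sound (·-identityʳ e)     = trans (∙-comm ⟦ e ⟧ (len 0)) (∙-identityˡ ⟦ e ⟧)
  sound (·-identityˡ e)     = ∙-identityˡ ⟦ e ⟧
  sound (·-zeroʳ e)         = ∙-comm ⟦ e ⟧ ∅
  sound (·-zeroˡ e)         = refl
  sound (·-assoc e f g)     = ∙-assoc ⟦ e ⟧ ⟦ f ⟧ ⟦ g ⟧
  sound (·-distribʳ e f g)  = ∙-distribʳ ⟦ e ⟧ ⟦ f ⟧ ⟦ g ⟧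
  sound (·-distribˡ e f g)  = ∙-distribˡ ⟦ e ⟧ ⟦ f ⟧ ⟦ g ⟧
  sound (*-unfoldʳ e)       = ⋆-unfold ⟦ e ⟧
  sound (*-unfoldˡ e)       = trans (⋆-unfold ⟦ e ⟧) (cong (len 0 ⊔_) (∙-comm ⟦ e ⟧ (⟦ e ⟧ ⋆)))
  sound (*-leastˡ e f g p)  = ⋆-least ⟦ e ⟧ ⟦ f ⟧ ⟦ g ⟧ (sound p)
  sound (*-leastʳ e f g p)
    -- Commuting the products in goal and hypothesis turns this into the left-handed rule with `f`
    -- and `g` exchanged.
    rewrite ∙-comm ⟦ e ⟧ (⟦ g ⟧ ⋆) = ⋆-least ⟦ e ⟧ ⟦ g ⟧ ⟦ f ⟧
      (subst (λ x → ⟦ e ⟧ ⊔ x ≤ ⟦ f ⟧) (∙-comm ⟦ f ⟧ ⟦ g ⟧) (sound p))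
  sound (⊗-distribˡ e f g)  = ⊠-distribˡ ⟦ e ⟧ ⟦ f ⟧ ⟦ g ⟧
  sound (⊗-assoc e f g)     = ⊠-assoc ⟦ e ⟧ ⟦ f ⟧ ⟦ g ⟧
  sound (⊗-comm e f)        = ⊠-comm ⟦ e ⟧ ⟦ f ⟧
  sound (⊗-zeroʳ e)         = ⊠-comm ⟦ e ⟧ ∅
  sound (⊗-identityʳ e)     = trans (⊠-comm ⟦ e ⟧ (len 0)) (⊠-identityˡ ⟦ e ⟧)
  sound (⊗-idem α)          = trans (⟦⌜⌝⟧≡len1 (α ⊗ α)) (sym (⟦⌜⌝⟧≡len1 α))
  -- After rewriting, the prefix `len 1 ⊠ len 1` computes to `len 1`.
  sound (⊗-sync α β e f) rewrite ⟦⌜⌝⟧≡len1 α | ⟦⌜⌝⟧≡len1 β =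
    ∙-⊠-interchange ⟦ e ⟧ ⟦ f ⟧

-- The two terms over one letter.

a* : Term 1
a* = letter zero *

-- With one letter there are two subsets, one of them empty. Hence every synchronous string is a
-- power of a single symbol.
𝒫ₙ1-unique : (x : 𝒫ₙ 1) → ⟦ letter zero ⟧SL ≡ x
𝒫ₙ1-unique (true  ∷ [] , _)             = refl
-- The non-emptiness proof is irrelevant, but it may still be used to reach a contradiction.
𝒫ₙ1-unique (false ∷ [] , [ nonempty ]) = ⊥-elim-irr (∉⊥ (proj₂ nonempty))

∈⟦a*⟧ : ∀ w → w ∈ ⟦ a* ⟧SKA
∈⟦a*⟧ []      = [] , [] , refl
∈⟦a*⟧ (x ∷ w) with us , us⊆a , refl ← ∈⟦a*⟧ w =
  (x ∷ []) ∷ us , cong (_∷ []) (𝒫ₙ1-unique x) ∷ us⊆a , refl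

theorem4p4 : ∃₂ λ (e f : Term 1) → ⟦ e ⟧SKA ≐ ⟦ f ⟧SKA × ¬ (e ≡SKA f)
theorem4p4 = a* ⊗ a* , a*
  -- One inclusion holds because `a*` contains every string; the other splits `w` as the product of
  -- the empty string with `w`.
  , ((λ {w} _ → ∈⟦a*⟧ w) , (λ {w} w∈ → [] , w , ∈⟦a*⟧ [] , w∈ , refl))
  -- Soundness would yield `† ≡ ω`, as `len 1 ⋆` is `ω` and `ω ⊠ ω` is `†`.
  , λ p → case sound p of λ ()
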